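{- Let $\mathbb{F}$ be a field, let $n$ be even, let $X=\{x_1,\ldots,x_n\}$, and let $P$ be a strict circular-interval ABP of size $S$ computing $f\in\mathbb{F}[x_1,\ldots,x_n]$. Then there exists a partition $\varphi:X\to Y\cup Z$ with $|\varphi(X)\cap Y|=|\varphi(X)\cap Z|=|X|/2$ such that $$\mathrm{rank}_\varphi(f)\le 2^{\sqrt n\,\log n\,\log S}\cdot 2^{\sqrt n}.$$
   Context: Partial derivative matrix. $Y$ and $Z$ are disjoint sets of variables with $|Y|=|Z|=n/2$, and a partition is an injective map $\varphi:X\to Y\cup Z$. For a polynomial $f$, $f^\varphi$ is obtained from $f$ by replacing each $x_i$ by $\varphi(x_i)$. For multilinear $f$, the partial derivative matrix $M_f$ with respect to $\varphi$ is the $2^{n/2}\times 2^{n/2}$ matrix over $\mathbb{F}$ with rows indexed by multilinear monomials $p$ in $Y$ and columns indexed by multilinear monomials $q$ in $Z$, with $M_f[p,q]$ equal to the coefficient of $pq$ in $f^\varphi$. $\mathrm{rank}_\varphi(f)$ is the rank of $M_f$ over $\mathbb{F}$. ABPs. An algebraic branching program (ABP) over $\mathbb{F}$ is a directed acyclic graph whose vertices are partitioned into layers $L_0,\ldots,L_\ell$, with edges only from $L_i$ to $L_{i+1}$; $L_0=\{s\}$ (source, the one vertex of in-degree 0) and $L_\ell=\{t\}$ (sink, the one vertex of out-degree 0). Each edge is labeled by an element of $X\cup\mathbb{F}$. The size is the number of nodes. The polynomial computed is the sum over all $s$-to-$t$ paths of the product of the edge labels. It is syntactic multilinear if every variable occurs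 at most once on every $s$-to-$t$ path. For nodes $u,v$, $X_{u,v}$ is the set of all variables occurring as labels on some $u$-to-$v$ path. Strict circular-interval ABPs. Let $\pi\in S_n$. An interval $I=[i,j]$ in $\{1,\ldots,n\}$ is a circular $\pi$-interval if $I=\{\pi(i),\pi(i+1),\ldots,\pi(j)\}$ for some $i,j\in[n]$ with $i<j$, or $I=\{\pi(i),\pi(i+1),\ldots,\pi(n),\pi(1),\ldots,\pi(j)\}$ for some $i,j\in[n]$ with $i>j$. Every such circular interval $[i,j]$ is viewed as a chord on a circle containing $n$ points (the chord joining the $i$-th and the $j$-th point). Two circular intervals are overlapping if the corresponding chords in the circle intersect, and non-overlapping otherwise. A syntactic multilinear ABP $P$ is a strict $\pi$-circular-interval ABP if (1) for any pair of nodes $u,v$ in $P$, the index set of $X_{u,v}$ is contained in some circular $\pi$-interval $I_{uv}$ in $[1,n]$; and (2) for any nodes $u,a,v$ in $P$, the circular $\pi$-intervals $I_{ua}$ and $I_{av}$ are non-overlapping. $P$ is a strict circular-interval ABP if it is a strict $\pi$-circular-interval ABP for some permutation $\pi\in S_n$.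
   Formalization: Intervals sharing a segment of the circle (e.g. nested ones) also count as overlapping, as with crossing chords alone the claim is false; condition (2) is required only for distinct u, a, v in order on a path; equality in the field is assumed decidable. -}

module Defs where

open import Algebra.Bundles using (CommutativeRing)
import Algebra.Properties.Monoid.Sum as MonoidSum
open import Data.Bool using (Bool; true; false)
open import Data.Fin as Fin using (Fin)
import Data.Fin.Properties as Fin
open import Data.Fin.Permutation using (Permutation′; _⟨$⟩ʳ_)
open import Data.Fin.Subset using (Subset; ∣_∣)
open import Data.List using (List; []; _∷_; [_]; length; filter; foldr; map; concatMap; allFin)
open import Data.List.Membership.Propositional using (_∈_)
open import Data.List.Relation.Unary.Unique.Propositional using (Unique)
open import Data.Maybe using (Maybe; just; nothing)
open import Data.Nat using (ℕ; zero; suc; NonZero; _+_; _*_; _^_; _/_; _≤_; _≟_)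
open import Data.Product using (Σ; ∃; ∃-syntax; Σ-syntax; _×_; _,_; proj₁; proj₂; map₂)
open import Data.Sum using (_⊎_; inj₁; inj₂)
open import Data.Sum.Properties using (≡-dec)
open import Data.Vec using (lookup; tabulate)
open import Function using (_∘_; _⇔_)
open import Function.Definitions using (Injective)
open import Level as Level using (Level; _⊔_)
open import Relation.Binary.Definitions using (Decidable; DecidableEquality)
open import Relation.Binary.PropositionalEquality using (_≡_; _≢_; refl)
open import Relation.Nullary using (¬_; Dec; yes; no; does; _×-dec_)

private variable
  c ℓ v : Level

------------------------------------------------------------------------
-- Fields and rank

-- Equality is decidable, as it is classically for every field.
record Field c ℓ : Set (Level.suc (c ⊔ ℓ)) where
  field
    commutativeRing : CommutativeRing c ℓ
  open CommutativeRing commutativeRing public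
    renaming (_+_ to _+ᶠ_; _*_ to _*ᶠ_)
  field
    _≈?_    : Decidable _≈_
    1≉0     : ¬ (1# ≈ 0#)
    inverse : ∀ x → ¬ (x ≈ 0#) → ∃[ y ] (x *ᶠ y ≈ 1#)

module _ (F : Field c ℓ) where
  open Field F
  open MonoidSum +-monoid using (sum)

  Matrix : Set → Set → Set c
  Matrix A B = A → B → Carrier

  module _ {A B : Set} (M : Matrix A B) where

    combination : ∀ {r} → (Fin r → A) → (Fin r → Carrier) → B → Carrier
    combination rows a q = sum λ i → a i *ᶠ M (rows i) q

    LinearlyIndependent : ∀ {r} → (Fin r → A) → Set (c ⊔ ℓ)
    LinearlyIndependent rows =
      ∀ a → (∀ q → combination rows a q ≈ 0#) → ∀ i → a i ≈ 0#

    Spanning : ∀ {r} → (Fin r → A) → Set (c ⊔ ℓ)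
    Spanning rows = ∀ p → ∃[ a ] ∀ q → M p q ≈ combination rows a q

    -- The row space has a basis consisting of r rows.
    IsRank : ℕ → Set (c ⊔ ℓ)
    IsRank r = Σ[ rows ∈ (Fin r → A) ] LinearlyIndependent rows × Spanning rows

------------------------------------------------------------------------
-- Polynomials, partitions and the partial derivative matrix

-- A polynomial is a finite formal sum of terms, each a scalar times a
-- word of (commuting) variables.  Like terms need not be collected.
Term : Field c ℓ → Set v → Set (c ⊔ v)
Term F V = Field.Carrier F × List V

Polynomial : Field c ℓ → Set v → Set (c ⊔ v)
Polynomial F V = List (Term F V)

rename : (F : Field c ℓ) {V W : Set} → (V → W) → Polynomial F V → Polynomial F W
rename F φ = map (map₂ (map φ))

-- h variables Y and h variables Z.
Y∪Z : ℕ → Set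
Y∪Z h = Fin h ⊎ Fin h

_≟ᵛ_ : ∀ {h} → DecidableEquality (Y∪Z h)
_≟ᵛ_ = ≡-dec Fin._≟_ Fin._≟_

Partition : ℕ → Set
Partition n = Σ[ φ ∈ (Fin n → Y∪Z (n / 2)) ] Injective _≡_ _≡_ φ

image∩Y image∩Z : ∀ {n} → Partition n → Subset (n / 2)
image∩Y (φ , _) = tabulate λ y → does (Fin.any? λ x → φ x ≟ᵛ inj₁ y)
image∩Z (φ , _) = tabulate λ z → does (Fin.any? λ x → φ x ≟ᵛ inj₂ z)

Balanced : ∀ {n} → Partition n → Set
Balanced {n} φ = ∣ image∩Y φ ∣ ≡ n / 2 × ∣ image∩Z φ ∣ ≡ n / 2

indicator : Bool → ℕ
indicator true  = 1
indicator false = 0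

module _ {h : ℕ} where

  exponent : Y∪Z h → List (Y∪Z h) → ℕ
  exponent x w = length (filter (x ≟ᵛ_) w)

  -- The word w is the multilinear monomial ∏_{y ∈ p} y · ∏_{z ∈ q} z.
  IsMonomial : Subset h → Subset h → List (Y∪Z h) → Set
  IsMonomial p q w = (∀ y → exponent (inj₁ y) w ≡ indicator (lookup p y))
                   × (∀ z → exponent (inj₂ z) w ≡ indicator (lookup q z))

  isMonomial? : ∀ p q w → Dec (IsMonomial p q w)
  isMonomial? p q w = Fin.all? (λ y → _ ≟ _) ×-dec Fin.all? (λ z → _ ≟ _)

module _ (F : Field c ℓ) where
  open Field F using (Carrier; _+ᶠ_; 0#)

  coefficient : ∀ {h} → Polynomial F (Y∪Z h) → Subset h → Subset h → Carrier
  coefficient f p q =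
    foldr _+ᶠ_ 0# (map proj₁ (filter (isMonomial? p q ∘ proj₂) f))

  partialDerivativeMatrix : ∀ {n} → Partition n → Polynomial F (Fin n) →
                            Matrix F (Subset (n / 2)) (Subset (n / 2))
  partialDerivativeMatrix (φ , _) f = coefficient (rename F φ f)

------------------------------------------------------------------------
-- Algebraic branching programs

data Label (F : Field c ℓ) (n : ℕ) : Set c where
  var   : Fin n → Label F n
  const : Field.Carrier F → Label F n

-- S is the size.  That the source has in-degree 0 and the sink has
-- out-degree 0 follows from the conditions on layers.
record ABP (F : Field c ℓ) (n S : ℕ) : Set c where
  field
    edge : Fin S → Fin S → Maybe (Label F n)

  Edge : Fin S → Fin S → Set c
  Edge u v = ∃[ a ] edge u v ≡ just a

  field
    layer        : Fin S → ℕ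
    depth        : ℕ
    source sink  : Fin S
    layer≤depth  : ∀ u → layer u ≤ depth
    edge-layer   : ∀ {u v} → Edge u v → layer v ≡ suc (layer u)
    layer-source : ∀ u → (layer u ≡ 0) ⇔ (u ≡ source)
    layer-sink   : ∀ u → (layer u ≡ depth) ⇔ (u ≡ sink)
    has-in-edge  : ∀ v → v ≢ source → ∃[ u ] Edge u v
    has-out-edge : ∀ u → u ≢ sink → ∃[ v ] Edge u v

module _ {F : Field c ℓ} {n S : ℕ} (P : ABP F n S) where
  open Field F using (_*ᶠ_; 1#)
  open ABP P

  infixr 5 _∷_ _·_

  data Path : Fin S → Fin S → Set c where
    []  : ∀ {u} → Path u u
    _∷_ : ∀ {u w v} → Edge u w → Path w v → Path u v

  _·_ : Label F n → Term F (Fin n) → Term F (Fin n)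
  var x   · (b , w) = b , x ∷ w
  const a · (b , w) = a *ᶠ b , w

  weight : ∀ {u v} → Path u v → Term F (Fin n)
  weight []            = 1# , []
  weight ((a , _) ∷ p) = a · weight p

  variables : ∀ {u v} → Path u v → List (Fin n)
  variables p = proj₂ (weight p)

  edges : ∀ u v → List (Edge u v)
  edges u v with edge u v
  ... | just a  = [ a , refl ]
  ... | nothing = []

  pathsOfLength : ℕ → ∀ u v → List (Path u v)
  pathsOfLength zero u v with u Fin.≟ v
  ... | yes refl = [ [] ]
  ... | no  _    = []
  pathsOfLength (suc k) u v =
    concatMap (λ w → concatMap (λ e → map (e ∷_) (pathsOfLength k w v)) (edges u w))
              (allFin S)

  -- Edges join consecutive layers, so every source-to-sink path has
  -- length depth.
  computed : Polynomial F (Fin n)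
  computed = map weight (pathsOfLength depth source sink)

  SyntacticMultilinear : Set c
  SyntacticMultilinear = (p : Path source sink) → Unique (variables p)

  _∈X⟨_,_⟩ : Fin n → Fin S → Fin S → Set c
  x ∈X⟨ u , v ⟩ = Σ[ p ∈ Path u v ] x ∈ variables p

------------------------------------------------------------------------
-- Circular intervals

-- The arc running clockwise from position first to position last on a
-- circle of n positions, wrapping around when last < first.
record Arc (n : ℕ) : Set where
  field
    first last : Fin n
    distinct   : first ≢ last

module _ {n : ℕ} where

  _∈ᵃ_ : Fin n → Arc n → Set
  k ∈ᵃ I = (first Fin.< last × first Fin.≤ k × k Fin.≤ last)
         ⊎ (last Fin.< first × (first Fin.≤ k ⊎ k Fin.≤ last))
    where open Arc I

  -- The circular π-interval given by an arc.
  _∈[_]_ : Fin n → Permutation′ n → Arc n → Set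
  x ∈[ π ] I = ∃[ k ] k ∈ᵃ I × π ⟨$⟩ʳ k ≡ x

  StrictlyBetween StrictlyOutside : Fin n → Fin n → Fin n → Set
  StrictlyBetween i j k = (i Fin.< k × k Fin.< j) ⊎ (j Fin.< k × k Fin.< i)
  StrictlyOutside i j k = (k Fin.< i × k Fin.< j) ⊎ (i Fin.< k × j Fin.< k)

  -- The chords joining the endpoints meet in an interior point.
  ChordsCross : Arc n → Arc n → Set
  ChordsCross I J =
      (StrictlyBetween I.first I.last J.first × StrictlyOutside I.first I.last J.last)
    ⊎ (StrictlyBetween I.first I.last J.last × StrictlyOutside I.first I.last J.first)
    where
    module I = Arc I
    module J = Arc J

  -- The arc contains the segment of the circle from position k to its
  -- cyclic successor.
  ContainsSegment : Arc n → Fin n → Set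
  ContainsSegment I k = (first Fin.< last × first Fin.≤ k × k Fin.< last)
                      ⊎ (last Fin.< first × (first Fin.≤ k ⊎ k Fin.< last))
    where open Arc I

  -- A chord does not determine which of its two sides is the interval, so
  -- the crossing of chords alone does not detect nested intervals, nor two
  -- intervals that jointly cover the circle.  These overlap as well: with
  -- crossing chords only, taking every interval to be a whole circle
  -- [i , i - 1] would make every syntactic multilinear ABP of depth less
  -- than 2 ^ (n / 2) strict, using n / 2 pairwise disjoint chords.
  -- Arcs sharing no more than endpoints do not overlap.
  Overlapping : Arc n → Arc n → Set
  Overlapping I J =
    ChordsCross I J ⊎ ∃[ k ] (ContainsSegment I k × ContainsSegment J k)

module _ {F : Field c ℓ} {n S : ℕ} (P : ABP F n S) where

  -- Non-overlap concerns nodes u, a, v in this order on a path; u, a, v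
  -- must be distinct, since I u u overlaps itself.
  StrictFor : Permutation′ n → Set c
  StrictFor π = Σ[ I ∈ (Fin S → Fin S → Arc n) ]
      (∀ u v x → _∈X⟨_,_⟩ P x u v → x ∈[ π ] I u v)
    × (∀ u a v → u ≢ a → a ≢ v → Path P u a → Path P a v →
         ¬ Overlapping (I u a) (I a v))

  StrictCircularInterval : Set c
  StrictCircularInterval = SyntacticMultilinear P × ∃ StrictFor

------------------------------------------------------------------------
-- The bound

-- √ n ≤ a / d (d positive)
SqrtAtMost : ℕ → ℕ → ℕ → Set
SqrtAtMost n a d = n * (d * d) ≤ a * a

-- log₂ m ≤ a / d, that is, m ≤ 2 ^ (a / d)
LogAtMost : ℕ → ℕ → ℕ → Set
LogAtMost m a d = m ^ d ≤ 2 ^ a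

-- r ≤ 2 ^ (√ n · log₂ n · log₂ S) · 2 ^ √ n for n, S ≥ 1: the right-hand
-- side is the infimum of 2 ^ (α β γ + α) over the rationals α ≥ √ n,
-- β ≥ log₂ n, γ ≥ log₂ S, written with a common denominator d.
RankBound : ℕ → ℕ → ℕ → Set
RankBound n S r = ∀ a b g d → .{{NonZero d}} →
  SqrtAtMost n a d → LogAtMost n b d → LogAtMost S g d →
  LogAtMost r (a * b * g + a * (d * d)) (d * d * d)

-- Colour a variable Y or Z according to which half of the circle its position
-- lies in.  Call a pair of nodes (u , v) bad if X u v contains both colours;
-- every arc containing X u v then contains one of the two segments joining the
-- halves.  Suppose w₀ , … , w₄ is a path with consecutive pairs bad.  The pairs
-- 01, 12, 13, 23, 34 are all bad, and two pairs ij, jk use different segments,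
-- as their arcs do not overlap.  Hence 12 and 13 use the same segment (not that
-- of 01), as do 13 and 23 (not that of 34), but 12 and 23 use different ones.
-- So chains of bad pairs have at most 3 links.
--
-- Split every path from u to the sink at its first edge v → w with (u , w) bad.
-- The part before the edge is monochromatic, and multiplying by a monochromatic
-- polynomial does not increase the number of products g(Y) · h(Z) needed, so
-- each link of a chain costs a factor of at most S² (the choice of the edge).
-- Hence the rank is at most S ^ 6, and √n · log₂ n ≥ 6 for n ≥ 6.  For n ≤ 4 the
-- trivial bound 2 ^ (n / 2) ≤ 2 ^ √n suffices.

module Submission where

open import Defs
import Algebra.Properties.Ring as RingProperties
import Algebra.Properties.Semiring.Sum as SemiringSum
open import Data.Bool as Bool using (Bool; true; false; not; if_then_else_; _∧_)
open import Data.Fin as Fin using (Fin; zero; suc; punchIn; punchOut; splitAt; toℕ; fromℕ<)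
open import Data.Fin.Permutation using (Permutation′; _⟨$⟩ʳ_; _⟨$⟩ˡ_; inverseˡ; inverseʳ)
import Data.Fin.Properties as Fin
open import Data.Fin.Subset using (Subset; ∣_∣)
open import Data.List as List using (List; []; _∷_; _++_; [_]; concatMap; allFin; tabulate; filter)
open import Data.List.Membership.Propositional using (_∈_)
open import Data.List.Properties using (filter-reject)
open import Data.List.Relation.Unary.Any using (here; there)
open import Data.Maybe using (Maybe; just; nothing)
open import Data.Nat as ℕ using (ℕ; zero; suc; _+_; _*_; _∸_; _^_; _/_; _≤_; _<_; z≤n; s≤s)
open import Data.Nat.Divisibility using (_∣_)
open import Data.Nat.DivMod using (m/n*n≡m)
import Data.Nat.Properties as ℕ
open import Data.Nat.Tactic.RingSolver using (solve-∀)
open import Data.Product using (∃; ∃-syntax; Σ-syntax; _×_; _,_; proj₁; proj₂)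
open import Data.Sum using (_⊎_; inj₁; inj₂; [_,_]′)
open import Data.Sum.Properties using ([,]-map)
import Data.Vec as Vec
open import Data.Vec.Functional using () renaming (_∷_ to _◃_)
import Data.Vec.Properties as Vec
open import Effect.Monad using (RawMonad)
open import Function using (_∘_; id; mk⇔; Equivalence; Inverse)
open import Function.Definitions using (Injective)
open import Level using (_⊔_)
open import Relation.Binary.PropositionalEquality as ≡ using (_≡_; _≢_)
import Relation.Binary.Reasoning.Setoid as SetoidReasoning
open import Relation.Nullary using (¬_; Dec; yes; no; does; ¬?; contradiction; _×-dec_)
open import Relation.Nullary.Decidable using
  (decidable-stable; dec-true; dec-false; does-⇔; ¬¬-excluded-middle)
open import Relation.Nullary.Negation using (¬¬-Monad)

-- Gaussian elimination and the rank of a matrix.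

module LinearAlgebra {c ℓ} (F : Field c ℓ) where
  open Field F hiding (zero)
  open RingProperties ring
  open SemiringSum semiring public using
    (sum; sum-cong-≋; sum-replicate-zero; ∑-distrib-+; ∑-comm; *-distribˡ-sum; *-distribʳ-sum)
  open SetoidReasoning setoid

  sum-zero : ∀ {n} {t : Fin n → Carrier} → (∀ i → t i ≈ 0#) → sum t ≈ 0#
  sum-zero {n} t≈0 = trans (sum-cong-≋ t≈0) (sum-replicate-zero n)

  sum-only : ∀ {n} {t : Fin n → Carrier} i → (∀ j → j ≡.≢ i → t j ≈ 0#) → sum t ≈ t i
  sum-only zero h = trans (+-congˡ (sum-zero λ j → h (suc j) λ ())) (+-identityʳ _)
  sum-only (suc i) h =
    trans (+-cong (h zero λ ()) (sum-only i λ j j≢i → h (suc j) (j≢i ∘ Fin.suc-injective)))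
          (+-identityˡ _)

  sum-neg : ∀ {n} (t : Fin n → Carrier) → sum (λ i → - t i) ≈ - sum t
  sum-neg t = begin
    sum (λ i → - t i)        ≈⟨ sum-cong-≋ (λ i → sym (-1*x≈-x (t i))) ⟩
    sum (λ i → - 1# *ᶠ t i)  ≈⟨ *-distribˡ-sum (- 1#) t ⟨
    - 1# *ᶠ sum t            ≈⟨ -1*x≈-x (sum t) ⟩
    - sum t                  ∎

  solve-leading : ∀ {p q x s} → p *ᶠ q ≈ 1# → x *ᶠ p +ᶠ s ≈ 0# → x ≈ - (s *ᶠ q)
  solve-leading {p} {q} {x} {s} pq≈1 eq = begin
    x              ≈⟨ *-identityʳ x ⟨
    x *ᶠ 1#        ≈⟨ *-congˡ pq≈1 ⟨
    x *ᶠ (p *ᶠ q)  ≈⟨ *-assoc x p q ⟨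
    x *ᶠ p *ᶠ q    ≈⟨ *-congʳ (+-inverseˡ-unique _ _ eq) ⟩
    - s *ᶠ q       ≈⟨ -‿distribˡ-* s q ⟨
    - (s *ᶠ q)     ∎

  Solution : ∀ {N r} → (Fin N → Fin r → Carrier) → (Fin r → Carrier) → Set ℓ
  Solution A x = ∀ i → sum (λ j → x j *ᶠ A i j) ≈ 0#

  TrivialKernel : ∀ {N r} → (Fin N → Fin r → Carrier) → Set _
  TrivialKernel A = ∀ x → Solution A x → ∀ j → x j ≈ 0#

  Degenerate : ∀ {N r} → (Fin N → Fin r → Carrier) → Set _
  Degenerate A = ∃[ x ] Solution A x × ∃[ j ] ¬ (x j ≈ 0#)

  module Pivot {N r} (A : Fin (suc N) → Fin (suc r) → Carrier) (i : Fin (suc N))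
               (q : Carrier) (pq≈1 : A i zero *ᶠ q ≈ 1#) where

    row : (Fin r → Carrier) → Fin (suc N) → Carrier
    row z k = sum λ j → z j *ᶠ A k (suc j)

    -- The Schur complement of the pivot: row `i` is used to clear the first column and is then
    -- dropped.
    reduced : Fin N → Fin r → Carrier
    reduced k j = A (punchIn i k) (suc j) - A i (suc j) *ᶠ q *ᶠ A (punchIn i k) zero

    leading : (Fin r → Carrier) → Carrier
    leading z = - (row z i *ᶠ q)

    -- Links the two systems: once `leading` fills in the first unknown, a reduced row and the
    -- corresponding original row take the same value, so solutions pass in both directions.
    reduced-row : ∀ z k → sum (λ j → z j *ᶠ reduced k j)
                        ≈ leading z *ᶠ A (punchIn i k) zero +ᶠ row z (punchIn i k)
    reduced-row z k = begin
      sum (λ j → z j *ᶠ (a j - b j *ᶠ q *ᶠ d))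
        ≈⟨ sum-cong-≋ {r} (λ j → x[y-z]≈xy-xz _ _ _) ⟩
      sum (λ j → z j *ᶠ a j - z j *ᶠ (b j *ᶠ q *ᶠ d))
        ≈⟨ ∑-distrib-+ (λ j → z j *ᶠ a j) (λ j → - (z j *ᶠ (b j *ᶠ q *ᶠ d))) ⟩
      sum (λ j → z j *ᶠ a j) +ᶠ sum (λ j → - (z j *ᶠ (b j *ᶠ q *ᶠ d)))
        ≈⟨ +-comm _ _ ⟩
      sum (λ j → - (z j *ᶠ (b j *ᶠ q *ᶠ d))) +ᶠ sum (λ j → z j *ᶠ a j)
        ≈⟨ +-congʳ (trans (sum-neg (λ j → z j *ᶠ (b j *ᶠ q *ᶠ d))) (-‿cong factor)) ⟩
      - (row z i *ᶠ q *ᶠ d) +ᶠ sum (λ j → z j *ᶠ a j)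
        ≈⟨ +-congʳ (-‿distribˡ-* _ _) ⟩
      leading z *ᶠ d +ᶠ sum (λ j → z j *ᶠ a j) ∎
      where
      a b : Fin r → Carrier
      a j = A (punchIn i k) (suc j)
      b j = A i (suc j)
      d = A (punchIn i k) zero
      factor : sum (λ j → z j *ᶠ (b j *ᶠ q *ᶠ d)) ≈ row z i *ᶠ q *ᶠ d
      factor = begin
        sum (λ j → z j *ᶠ (b j *ᶠ q *ᶠ d))
          ≈⟨ sum-cong-≋ {r} (λ j → trans (*-congˡ (*-assoc _ _ _)) (sym (*-assoc _ _ _))) ⟩
        sum (λ j → z j *ᶠ b j *ᶠ (q *ᶠ d)) ≈⟨ *-distribʳ-sum (q *ᶠ d) (λ j → z j *ᶠ b j) ⟨
        row z i *ᶠ (q *ᶠ d)                ≈⟨ *-assoc _ _ _ ⟨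
        row z i *ᶠ q *ᶠ d                  ∎

    trivial-kernel : TrivialKernel reduced → TrivialKernel A
    trivial-kernel triv x sol = λ { zero → x₀≈0 ; (suc j) → xₛ j }
      where
      x₀ : x zero ≈ leading (x ∘ suc)
      x₀ = solve-leading pq≈1 (sol i)
      xₛ : ∀ j → x (suc j) ≈ 0#
      xₛ = triv (x ∘ suc) λ k →
        trans (reduced-row (x ∘ suc) k) (trans (+-congʳ (*-congʳ (sym x₀))) (sol (punchIn i k)))
      x₀≈0 : x zero ≈ 0#
      x₀≈0 = begin
        x zero             ≈⟨ x₀ ⟩
        leading (x ∘ suc)  ≈⟨ -‿cong (*-congʳ (sum-zero λ j → trans (*-congʳ (xₛ j)) (zeroˡ _))) ⟩
        - (0# *ᶠ q)        ≈⟨ -‿cong (zeroˡ q) ⟩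
        - 0#               ≈⟨ -0#≈0# ⟩
        0#                 ∎

    degenerate : Degenerate reduced → Degenerate A
    degenerate (z , sol , j , zⱼ≉0) = leading z ◃ z , solution , suc j , zⱼ≉0
      where
      pivotRow : leading z *ᶠ A i zero +ᶠ row z i ≈ 0#
      pivotRow = begin
        - (row z i *ᶠ q) *ᶠ A i zero +ᶠ row z i  ≈⟨ +-congʳ (-‿distribˡ-* _ _) ⟨
        - (row z i *ᶠ q *ᶠ A i zero) +ᶠ row z i
          ≈⟨ +-congʳ (-‿cong (trans (*-assoc _ _ _) (trans (*-congˡ (trans (*-comm _ _) pq≈1)) (*-identityʳ _)))) ⟩
        - row z i +ᶠ row z i                     ≈⟨ -‿inverseˡ _ ⟩
        0#                                       ∎
      solution : Solution A (leading z ◃ z)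
      solution k with i Fin.≟ k
      ... | yes ≡.refl = pivotRow
      ... | no i≢k = ≡.subst (λ k → leading z *ᶠ A k zero +ᶠ row z k ≈ 0#) (Fin.punchIn-punchOut i≢k)
                       (trans (sym (reduced-row z (punchOut i≢k))) (sol (punchOut i≢k)))

  unit : ∀ {r} → Fin (suc r) → Carrier
  unit = 1# ◃ λ _ → 0#

  sum-unit : ∀ {r} (t : Fin (suc r) → Carrier) → sum (λ j → unit j *ᶠ t j) ≈ t zero
  sum-unit t = trans (+-cong (*-identityˡ _) (sum-zero λ j → zeroˡ (t (suc j)))) (+-identityʳ _)

  -- Each pivot uses up one row, which yields `r ≤ N` when every column finds a pivot. A column
  -- without a pivot leaves its unknown free and gives a nonzero solution.
  eliminate : ∀ {N} r (A : Fin N → Fin r → Carrier) →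
              (TrivialKernel A × r ≤ N) ⊎ Degenerate A
  eliminate zero A = inj₁ ((λ _ _ ()) , z≤n)
  eliminate {N} (suc r) A with Fin.any? (λ i → ¬? (A i zero ≈? 0#))
  ... | no none = inj₂ (unit ,
          (λ i → trans (sum-unit (A i)) (decidable-stable (A i zero ≈? 0#) λ Aᵢ≉0 → none (i , Aᵢ≉0))) ,
          zero , 1≉0)
  eliminate {suc N} (suc r) A | yes (i , Aᵢ≉0) = go (eliminate r reduced)
    where
    open Pivot A i (proj₁ (inverse _ Aᵢ≉0)) (proj₂ (inverse _ Aᵢ≉0))
    go : (TrivialKernel reduced × r ≤ N) ⊎ Degenerate reduced →
         (TrivialKernel A × suc r ≤ suc N) ⊎ Degenerate A
    go (inj₁ (triv , r≤N)) = inj₁ (trivial-kernel triv , s≤s r≤N)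
    go (inj₂ deg)         = inj₂ (degenerate deg)

  module _ {A B : Set} (M : Matrix F A B) where

    InSpan : ∀ {r} → (Fin r → A) → A → Set _
    InSpan rows p = ∃[ a ] ∀ q → M p q ≈ combination F M rows a q

    module _ {b} (column : Fin b → B) (column-surjective : ∀ q → ∃[ i ] column i ≡ q) where

      -- Greedy selection, starting from the end of `f`: a new row is kept when elimination finds
      -- only the trivial relation between it and the rows kept so far.
      extract-basis : ∀ {m} (f : Fin m → A) → ∃[ r ] Σ[ rows ∈ (Fin r → A) ]
                      LinearlyIndependent F M rows × ∀ i → InSpan rows (f i)
      extract-basis {zero} f = 0 , (λ ()) , (λ _ _ ()) , λ ()
      extract-basis {suc m} f with extract-basis (f ∘ suc)
      ... | r , rows , indep , span
        with eliminate (suc r) (λ i j → M ((f zero ◃ rows) j) (column i))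
      ... | inj₁ (triv , _) =
        suc r , f zero ◃ rows , (λ a comb≈0 → triv a λ i → comb≈0 (column i)) , λ where
          zero    → unit , λ q → sym (sum-unit λ j → M ((f zero ◃ rows) j) q)
          (suc i) → 0# ◃ proj₁ (span i) , λ q →
            trans (proj₂ (span i) q) (sym (trans (+-congʳ (zeroˡ _)) (+-identityˡ _)))
      ... | inj₂ (x , sol , j , xⱼ≉0) = r , rows , indep , λ { zero → spanned ; (suc i) → span i }
        where
        relation : ∀ q → x zero *ᶠ M (f zero) q +ᶠ combination F M rows (x ∘ suc) q ≈ 0#
        relation q with column-surjective q
        ... | i , ≡.refl = sol i
        -- The coefficient of the new row is nonzero, since otherwise independence of the kept rows
        -- would make the whole relation trivial. Dividing by it puts the new row in their span.
        vanish : x zero ≈ 0# → ∀ j → x j ≈ 0#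
        vanish x₀≈0 zero    = x₀≈0
        vanish x₀≈0 (suc j) = indep (x ∘ suc) (λ q →
          trans (sym (trans (+-congʳ (trans (*-congʳ x₀≈0) (zeroˡ _))) (+-identityˡ _))) (relation q)) j
        spanned : InSpan rows (f zero)
        spanned = let y , x₀y≈1 = inverse (x zero) (λ x₀≈0 → xⱼ≉0 (vanish x₀≈0 j)) in
          (λ j → - (y *ᶠ x (suc j))) , λ q → begin
            M (f zero) q
              ≈⟨ solve-leading x₀y≈1 (trans (+-congʳ (*-comm _ _)) (relation q)) ⟩
            - (combination F M rows (x ∘ suc) q *ᶠ y)
              ≈⟨ -‿cong (trans (*-comm _ _) (*-distribˡ-sum y (λ j → x (suc j) *ᶠ M (rows j) q))) ⟩
            - sum (λ j → y *ᶠ (x (suc j) *ᶠ M (rows j) q))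
              ≈⟨ sum-neg (λ j → y *ᶠ (x (suc j) *ᶠ M (rows j) q)) ⟨
            sum (λ j → - (y *ᶠ (x (suc j) *ᶠ M (rows j) q)))
              ≈⟨ sum-cong-≋ {r} (λ j → trans (-‿cong (sym (*-assoc _ _ _))) (-‿distribˡ-* _ _)) ⟩
            combination F M rows (λ j → - (y *ᶠ x (suc j))) q ∎

      rank-exists : ∀ {a} (row : Fin a → A) → (∀ p → ∃[ i ] row i ≡ p) → ∃[ r ] IsRank F M r
      rank-exists row row-surjective =
        let r , rows , indep , span = extract-basis row in
        r , rows , indep , λ p → let i , eq = row-surjective p in ≡.subst (InSpan rows) eq (span i)

      rank≤columns : ∀ {r} → IsRank F M r → r ≤ b
      rank≤columns {r} (rows , indep , _) with eliminate r (λ i j → M (rows j) (column i))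
      ... | inj₁ (_ , r≤b) = r≤b
      ... | inj₂ (x , sol , j , xⱼ≉0) = contradiction (indep x zeroes j) xⱼ≉0
        where
        zeroes : ∀ q → combination F M rows x q ≈ 0#
        zeroes q with column-surjective q
        ... | i , ≡.refl = sol i

    -- With more than `N` independent rows, their coefficient vectors in `N`-dimensional space would
    -- satisfy a nontrivial relation, and the factorization transfers it to the rows of `M`.
    rank≤factorization : ∀ {N r} (a : Fin N → A → Carrier) (b : Fin N → B → Carrier) →
      (∀ p q → M p q ≈ sum (λ i → a i p *ᶠ b i q)) → IsRank F M r → r ≤ N
    rank≤factorization {N} {r} a b M≈ab (rows , indep , _)
      with eliminate r (λ i j → a i (rows j))
    ... | inj₁ (_ , r≤N) = r≤N
    ... | inj₂ (x , sol , j , xⱼ≉0) = contradiction (indep x zeroes j) xⱼ≉0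
      where
      zeroes : ∀ q → combination F M rows x q ≈ 0#
      zeroes q = begin
        sum (λ j → x j *ᶠ M (rows j) q)
          ≈⟨ sum-cong-≋ (λ j → trans (*-congˡ (M≈ab (rows j) q))
               (trans (*-distribˡ-sum (x j) (λ i → a i (rows j) *ᶠ b i q))
                 (sum-cong-≋ {N} λ i → sym (*-assoc (x j) (a i (rows j)) (b i q))))) ⟩
        sum (λ j → sum λ i → x j *ᶠ a i (rows j) *ᶠ b i q)
          ≈⟨ ∑-comm (λ j i → x j *ᶠ a i (rows j) *ᶠ b i q) ⟩
        sum (λ i → sum λ j → x j *ᶠ a i (rows j) *ᶠ b i q)
          ≈⟨ sum-zero (λ i → trans (sym (*-distribʳ-sum (b i q) (λ j → x j *ᶠ a i (rows j))))
               (trans (*-congʳ (sol i)) (zeroˡ _))) ⟩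
        0# ∎

-- Functionals on states and their separable decompositions.

-- A polynomial acts on a state ρ by sending each word w to
-- ρ true (Y-letters of w) · ρ false (Z-letters of w).  Such a functional with
-- N separable terms yields a factorization of the partial derivative matrix
-- through N dimensions.  Factors of colour not d are held fixed in Factored d b,
-- which makes sums and multiples by words of colour d cost no new terms.
module Separability {c ℓ} (F : Field c ℓ) {n : ℕ} (color : Fin n → Bool) where
  open Field F hiding (zero)
  open LinearAlgebra F
  open SetoidReasoning setoid

  WordMap : Set c
  WordMap = List (Fin n) → Carrier

  State : Set c
  State = Bool → WordMap

  Functional : Set c
  Functional = State → Carrier

  -- Composing a functional with `extend x` multiplies the underlying polynomial by `x`: the
  -- component of the colour of `x` receives its word with `x` prepended.
  extend : Fin n → State → State
  extend x ρ d = if does (color x Bool.≟ d) then ρ d ∘ (x ∷_) else ρ d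

  extend-same : ∀ {x d} → color x ≡ d → ∀ ρ → extend x ρ d ≡ ρ d ∘ (x ∷_)
  extend-same {x} {d} eq ρ rewrite dec-true (color x Bool.≟ d) eq = ≡.refl

  extend-other : ∀ {x d} → color x ≢ d → ∀ ρ → extend x ρ d ≡ ρ d
  extend-other {x} {d} neq ρ rewrite dec-false (color x Bool.≟ d) neq = ≡.refl

  act : Maybe (Label F n) → Functional → Functional
  act nothing          Φ ρ = 0#
  act (just (var x))   Φ ρ = Φ (extend x ρ)
  act (just (const a)) Φ ρ = a *ᶠ Φ ρ

  -- The premise is limited to labels actually present, so that a use may draw on facts about the
  -- edge, such as the layer of its endpoint.
  act-cong : ∀ m {Φ Ψ} → (∀ a → m ≡ just a → ∀ ρ → Φ ρ ≈ Ψ ρ) → ∀ ρ → act m Φ ρ ≈ act m Ψ ρ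
  act-cong nothing          h ρ = refl
  act-cong (just (var x))   h ρ = h _ ≡.refl _
  act-cong (just (const a)) h ρ = *-congˡ (h _ ≡.refl ρ)

  act-vanish : ∀ m {Φ} → (∀ a → m ≡ just a → ∀ ρ → Φ ρ ≈ 0#) → ∀ ρ → act m Φ ρ ≈ 0#
  act-vanish nothing          h ρ = refl
  act-vanish (just (var x))   h ρ = h _ ≡.refl _
  act-vanish (just (const a)) h ρ = trans (*-congˡ (h _ ≡.refl ρ)) (zeroʳ a)

  act-sum : ∀ m {k} (Φ : Fin k → Functional) ρ →
            act m (λ ρ → sum λ i → Φ i ρ) ρ ≈ sum λ i → act m (Φ i) ρ
  act-sum nothing  {k}      Φ ρ = sym (sum-replicate-zero k)
  act-sum (just (var x))    Φ ρ = refl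
  act-sum (just (const a))  Φ ρ = *-distribˡ-sum a λ i → Φ i ρ

  record Factored (d : Bool) {N : ℕ} (b : Fin N → WordMap → Carrier) (Φ : Functional) : Set (c ⊔ ℓ) where
    constructor factored
    field
      coefficients  : Fin N → WordMap → Carrier
      factorization : ∀ ρ → Φ ρ ≈ sum λ i → coefficients i (ρ d) *ᶠ b i (ρ (not d))
  open Factored


  Separable : Bool → ℕ → Functional → Set _
  Separable d N Φ = Σ[ b ∈ (Fin N → WordMap → Carrier) ] Factored d b Φ

  module _ {d : Bool} {N : ℕ} {b : Fin N → WordMap → Carrier} where

    factored-cong : ∀ {Φ Ψ} → (∀ ρ → Φ ρ ≈ Ψ ρ) → Factored d b Ψ → Factored d b Φ
    factored-cong Φ≈Ψ (factored a Ψ≈) = factored a λ ρ → trans (Φ≈Ψ ρ) (Ψ≈ ρ)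

    factored-zero : ∀ {Φ} → (∀ ρ → Φ ρ ≈ 0#) → Factored d b Φ
    factored-zero Φ≈0 = factored (λ _ _ → 0#) λ ρ →
      trans (Φ≈0 ρ) (sym (sum-zero λ i → zeroˡ (b i (ρ (not d)))))

    factored-sum : ∀ {k} {Φ : Fin k → Functional} → (∀ x → Factored d b (Φ x)) →
                   Factored d b λ ρ → sum λ x → Φ x ρ
    factored-sum {k} {Φ} f = factored (λ i μ → sum λ x → a x i μ) λ ρ → begin
      sum (λ x → Φ x ρ)
        ≈⟨ sum-cong-≋ (λ x → factorization (f x) ρ) ⟩
      sum (λ x → sum λ i → a x i (ρ d) *ᶠ b i (ρ (not d)))
        ≈⟨ ∑-comm (λ x i → a x i (ρ d) *ᶠ b i (ρ (not d))) ⟩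
      sum (λ i → sum λ x → a x i (ρ d) *ᶠ b i (ρ (not d)))
        ≈⟨ sum-cong-≋ {N} (λ i → *-distribʳ-sum (b i (ρ (not d))) (λ x → a x i (ρ d))) ⟨
      sum (λ i → (sum λ x → a x i (ρ d)) *ᶠ b i (ρ (not d))) ∎
      where
      a = λ x → coefficients (f x)

    factored-+ : ∀ {Φ Ψ} → Factored d b Φ → Factored d b Ψ → Factored d b λ ρ → Φ ρ +ᶠ Ψ ρ
    factored-+ {Φ} {Ψ} (factored a Φ≈) (factored a′ Ψ≈) = factored (λ i μ → a i μ +ᶠ a′ i μ) λ ρ → begin
      Φ ρ +ᶠ Ψ ρ ≈⟨ +-cong (Φ≈ ρ) (Ψ≈ ρ) ⟩
      _          ≈⟨ ∑-distrib-+ (λ i → a i (ρ d) *ᶠ b i (ρ (not d))) (λ i → a′ i (ρ d) *ᶠ b i (ρ (not d))) ⟨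
      _          ≈⟨ sum-cong-≋ {N} (λ i → distribʳ (b i (ρ (not d))) (a i (ρ d)) (a′ i (ρ d))) ⟨
      sum (λ i → (a i (ρ d) +ᶠ a′ i (ρ d)) *ᶠ b i (ρ (not d))) ∎

    factored-scale : ∀ {Φ} s → Factored d b Φ → Factored d b λ ρ → s *ᶠ Φ ρ
    factored-scale s (factored a Φ≈) = factored (λ i μ → s *ᶠ a i μ) λ ρ →
      trans (*-congˡ (Φ≈ ρ)) (trans (*-distribˡ-sum s λ i → a i (ρ d) *ᶠ b i (ρ (not d)))
        (sum-cong-≋ {N} λ i → sym (*-assoc s (a i (ρ d)) (b i (ρ (not d))))))

    factored-extend : ∀ {x Φ} → color x ≡ d → Factored d b Φ → Factored d b (Φ ∘ extend x)
    factored-extend {x} {Φ} same (factored a Φ≈) = factored (λ i μ → a i (μ ∘ (x ∷_))) λ ρ →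
      trans (Φ≈ (extend x ρ)) (reflexive (≡.cong₂ (λ μ ν → sum λ i → a i μ *ᶠ b i ν)
        (extend-same same ρ) (extend-other (λ eq → not≢ (≡.trans (≡.sym same) eq)) ρ)))
      where
      not≢ : ∀ {d} → d ≢ not d
      not≢ {true}  ()
      not≢ {false} ()

  separable-zero : ∀ {d N Φ} → (∀ ρ → Φ ρ ≈ 0#) → Separable d N Φ
  separable-zero Φ≈0 = (λ _ _ → 0#) , factored-zero Φ≈0

  -- Separability leaves both families of factors free, so the colours trade places by
  -- commutativity. The family held fixed can thus be chosen to suit the letters multiplied next.
  separable-swap : ∀ {d N Φ} e → Separable d N Φ → Separable e N Φ
  separable-swap {true}  true  = id
  separable-swap {false} false = id
  separable-swap {true} {N} false (b , factored a Φ≈) =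
    a , factored b λ ρ → trans (Φ≈ ρ) (sum-cong-≋ {N} λ i → *-comm (a i (ρ true)) (b i (ρ false)))
  separable-swap {false} {N} true (b , factored a Φ≈) =
    a , factored b λ ρ → trans (Φ≈ ρ) (sum-cong-≋ {N} λ i → *-comm (a i (ρ false)) (b i (ρ true)))

  separable-extend : ∀ {d N Φ} x → Separable d N Φ → Separable d N (Φ ∘ extend x)
  separable-extend {d} x s = separable-swap d
    (let b , f = separable-swap (color x) s in b , factored-extend ≡.refl f)

  separable-act : ∀ {d N Φ} m → Separable d N Φ → Separable d N (act m Φ)
  separable-act nothing          s       = separable-zero λ _ → refl
  separable-act (just (var x))   s       = separable-extend x s
  separable-act (just (const a)) (b , f) = b , factored-scale a f

  sum-splitAt : ∀ {k} (f : Fin k → Carrier) {l} (g : Fin l → Carrier) →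
                sum (λ i → [ f , g ]′ (splitAt k i)) ≈ sum f +ᶠ sum g
  sum-splitAt {zero}  f g = sym (+-identityˡ _)
  sum-splitAt {suc k} f {l} g = begin
    f zero +ᶠ sum (λ i → [ f , g ]′ (splitAt (suc k) (suc i)))
      ≈⟨ +-congˡ (sum-cong-≋ {k + l} λ i → reflexive ([,]-map (splitAt k i))) ⟩
    f zero +ᶠ sum (λ i → [ f ∘ suc , g ]′ (splitAt k i))  ≈⟨ +-congˡ (sum-splitAt (f ∘ suc) g) ⟩
    f zero +ᶠ (sum (f ∘ suc) +ᶠ sum g)                    ≈⟨ +-assoc _ _ _ ⟨
    sum f +ᶠ sum g                                        ∎

  separable-+ : ∀ {d N N′ Φ Ψ} → Separable d N Φ → Separable d N′ Ψ →
                Separable d (N + N′) λ ρ → Φ ρ +ᶠ Ψ ρ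
  separable-+ {d} {N} {N′} {Φ} {Ψ} (b , factored a Φ≈) (b′ , factored a′ Ψ≈) =
    (λ i → [ b , b′ ]′ (splitAt N i)) , factored (λ i → [ a , a′ ]′ (splitAt N i)) λ ρ → begin
      Φ ρ +ᶠ Ψ ρ  ≈⟨ +-cong (Φ≈ ρ) (Ψ≈ ρ) ⟩
      _           ≈⟨ sum-splitAt (λ i → a i (ρ d) *ᶠ b i (ρ (not d))) (λ i → a′ i (ρ d) *ᶠ b′ i (ρ (not d))) ⟨
      _           ≈⟨ sum-cong-≋ {N + N′} (λ i → reflexive (merge ρ (splitAt N i))) ⟩
      sum (λ i → [ a , a′ ]′ (splitAt N i) (ρ d) *ᶠ [ b , b′ ]′ (splitAt N i) (ρ (not d))) ∎
    where
    merge : ∀ ρ s → [ (λ i → a i (ρ d) *ᶠ b i (ρ (not d))) , (λ i → a′ i (ρ d) *ᶠ b′ i (ρ (not d))) ]′ s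
                  ≡ [ a , a′ ]′ s (ρ d) *ᶠ [ b , b′ ]′ s (ρ (not d))
    merge ρ (inj₁ _) = ≡.refl
    merge ρ (inj₂ _) = ≡.refl

  separable-cong : ∀ {d N Φ Ψ} → (∀ ρ → Φ ρ ≈ Ψ ρ) → Separable d N Ψ → Separable d N Φ
  separable-cong Φ≈Ψ (b , f) = b , factored-cong Φ≈Ψ f

  separable-if : ∀ {a} {A : Set a} {d N Φ} (A? : Dec A) → (A → Separable d N Φ) →
                 Separable d N λ ρ → if does A? then Φ ρ else 0#
  separable-if (yes p) s = s p
  separable-if (no _)  s = separable-zero λ _ → refl

  separable-sum : ∀ {d N k} {Φ : Fin k → Functional} → (∀ x → Separable d N (Φ x)) →
                  Separable d (k * N) λ ρ → sum λ x → Φ x ρ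
  separable-sum {k = zero}  s = separable-zero λ _ → refl
  separable-sum {k = suc k} s = separable-+ (s zero) (separable-sum (s ∘ suc))

  separable-mono : ∀ {d N N′ Φ} → N ≤ N′ → Separable d N Φ → Separable d N′ Φ
  separable-mono {d} {N} {N′} {Φ} N≤N′ s =
    ≡.subst (λ N → Separable d N Φ) (ℕ.m+[n∸m]≡n N≤N′)
      (separable-cong (λ ρ → sym (+-identityʳ _)) (separable-+ s (separable-zero {N = N′ ∸ N} λ _ → refl)))

-- Weighted walks in the branching program.

module Program {c ℓ} {F : Field c ℓ} {n S : ℕ} (P : ABP F n S) (color : Fin n → Bool) where
  open Field F hiding (zero)
  open LinearAlgebra F
  open Separability F color
  open SetoidReasoning setoid
  open ABP P

  path-layer : ∀ {u v} → Path P u v → layer u ≤ layer v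
  path-layer []      = ℕ.≤-refl
  path-layer {u} {v} (e ∷ p) = ℕ.≤-trans (ℕ.n≤1+n _) (≡.subst (_≤ layer v) (edge-layer e) (path-layer p))

  loop-free : ∀ {u} (p : Path P u u) → variables P p ≡ []
  loop-free []      = ≡.refl
  loop-free {u} (e ∷ p) =
    contradiction (≡.subst (_≤ layer u) (edge-layer e) (path-layer p)) ℕ.1+n≰n

  module _ (final step : Fin S → Functional) (open? : Fin S → Bool) where

    -- The weighted walks that take k steps and end with final, or stop after
    -- fewer than k steps with step, entering open nodes only.
    walk : ℕ → Fin S → Functional
    walk zero    v ρ = final v ρ
    walk (suc k) v ρ =
      step v ρ +ᶠ sum λ x → if open? x then act (edge v x) (walk k x) ρ else 0#

    walk-vanish : ∀ k v → (∀ w → Path P v w → (∀ ρ → final w ρ ≈ 0#) × (∀ ρ → step w ρ ≈ 0#)) →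
                  ∀ ρ → walk k v ρ ≈ 0#
    walk-vanish zero    v h ρ = proj₁ (h v []) ρ
    walk-vanish (suc k) v h ρ = trans (+-cong (proj₂ (h v []) ρ) (sum-zero term)) (+-identityˡ 0#)
      where
      term : ∀ x → (if open? x then act (edge v x) (walk k x) ρ else 0#) ≈ 0#
      term x with open? x
      ... | false = refl
      ... | true  = act-vanish (edge v x) (λ a e → walk-vanish k x λ w p → h w ((a , e) ∷ p)) ρ

    module _ {d N} {b : Fin N → WordMap → Carrier} (target : Fin S)
             (off : ∀ v → v ≢ target → (∀ ρ → final v ρ ≈ 0#) × (∀ ρ → step v ρ ≈ 0#))
             (on  : Factored d b (final target) × Factored d b (step target)) where

      piece : ∀ v → Factored d b (final v) × Factored d b (step v)
      piece v with v Fin.≟ target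
      ... | yes ≡.refl = on
      ... | no v≢      = factored-zero (proj₁ (off v v≢)) , factored-zero (proj₂ (off v v≢))

      -- All contributing walks end at `target`, so they multiply only by scalars and letters of
      -- colour `d`, and the family `b` given at `target` serves the whole sum.
      walk-factored : ∀ k v → (∀ x → _∈X⟨_,_⟩ P x v target → color x ≡ d) → Factored d b (walk k v)
      walk-factored zero    v mono = proj₁ (piece v)
      walk-factored (suc k) v mono = factored-+ (proj₂ (piece v)) (factored-sum term)
        where
        term : ∀ x → Factored d b λ ρ → if open? x then act (edge v x) (walk k x) ρ else 0#
        term x with open? x | edge v x in eq
        ... | false | _                = factored-zero λ _ → refl
        ... | true  | nothing          = factored-zero λ _ → refl
        ... | true  | just (const a)   =
          factored-scale a (walk-factored k x λ z (p , z∈) → mono z ((_ , eq) ∷ p , z∈))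
        ... | true  | just (var y) with color y Bool.≟ d
        ...   | yes same = factored-extend same
                (walk-factored k x λ z (p , z∈) → mono z ((_ , eq) ∷ p , there z∈))
        -- If a path led on from `x` to `target`, then `y` would be a letter of the wrong colour on
        -- a path to `target`. Hence `target` is unreachable from `x` and the term is zero.
        ...   | no differ = factored-zero λ ρ → walk-vanish k x
                (λ w p → off w λ { ≡.refl → differ (mono y ((_ , eq) ∷ p , here ≡.refl)) }) (extend y ρ)

  empty : Functional
  empty ρ = ρ true [] *ᶠ ρ false []

  δ : Fin S → Functional → Fin S → Functional
  δ u Φ v ρ = if does (v Fin.≟ u) then Φ ρ else 0#

  δ-on : ∀ u Φ ρ → δ u Φ u ρ ≡ Φ ρ
  δ-on u Φ ρ rewrite dec-true (u Fin.≟ u) ≡.refl = ≡.refl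

  δ-off : ∀ {u v} → v ≢ u → ∀ Φ ρ → δ u Φ v ρ ≡ 0#
  δ-off {u} {v} v≢u Φ ρ rewrite dec-false (v Fin.≟ u) v≢u = ≡.refl

  nought : Fin S → Functional
  nought _ _ = 0#

  -- With no early stopping and all nodes open, these are the walks of exactly `k` steps that end at
  -- `sink`.
  total : ℕ → Fin S → Functional
  total = walk (δ sink empty) nought (λ _ → true)

  -- One term suffices because the functional applied at the sink is the single product `empty`.
  total-separable : ∀ {u d} → (∀ x → _∈X⟨_,_⟩ P x u sink → color x ≡ d) → ∀ k → Separable d 1 (total k u)
  total-separable {u} {d} mono k = _ , walk-factored _ _ _ sink
    (λ v v≢ → (λ ρ → reflexive (δ-off v≢ empty ρ)) , λ _ → refl)
    (factored-cong (λ ρ → reflexive (δ-on sink empty ρ)) (proj₂ (base d)) , factored-zero λ _ → refl)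
    k u mono
    where
    base : ∀ d → Separable d 1 empty
    base d = separable-swap d ((λ _ ν → ν []) , factored (λ _ μ → μ []) λ ρ → sym (+-identityʳ _))

  -- cut v w collects the paths whose first edge into a bad node is v → w.
  module Cut (bad : Fin S → Bool) (sink-bad : bad sink ≡ true) where

    -- The part of a path from the edge `v → w` on; a path from `w` to the sink has
    -- `depth ∸ layer w` steps.
    joint : Fin S → Fin S → Functional
    joint v w ρ = if bad w then act (edge v w) (total (depth ∸ layer w) w) ρ else 0#

    -- The zero at a bad `v` lets such terms be dismissed at once; walks entering good nodes only
    -- never reach a bad `v` from a good start.
    guarded : Fin S → Fin S → Functional
    guarded v w ρ = if bad v then 0# else joint v w ρ

    cut : Fin S → Fin S → ℕ → Fin S → Functional
    cut v w = walk nought (δ v (guarded v w)) (not ∘ bad)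

    good-step : ∀ v w k u x ρ → Carrier
    good-step v w k u x ρ = if not (bad x) then act (edge u x) (cut v w k x) ρ else 0#

    -- A path from a good node to the bad sink has exactly one first edge into a bad node. By
    -- induction on the length, the first edge either enters a bad node and contributes to `joint`,
    -- or enters a good node and leaves the cut for later. The equation on layers makes the
    -- remaining number of steps agree with the one in `joint`.
    total-cut : ∀ k u → k + layer u ≡ depth → bad u ≡ false →
                ∀ ρ → total k u ρ ≈ sum λ v → sum λ w → cut v w k u ρ
    -- A good node is not the sink, so no walk of length zero counts and both sides are zero.
    total-cut zero u eq good ρ = trans
      (reflexive (δ-off {sink} {u} (λ { ≡.refl → contradiction (≡.trans (≡.sym sink-bad) good) λ () }) empty ρ))
      (sym (sum-zero {S} λ v → sum-zero {S} {λ _ → 0#} λ w → refl))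
    total-cut (suc k) u eq good ρ = begin
      0# +ᶠ sum (λ x → act (edge u x) (total k x) ρ)
        ≈⟨ +-identityˡ _ ⟩
      sum (λ x → act (edge u x) (total k x) ρ)
        ≈⟨ sum-cong-≋ by-step ⟩
      sum (λ x → joint u x ρ +ᶠ sum λ v → sum λ w → good-step v w k u x ρ)
        ≈⟨ ∑-distrib-+ (λ x → joint u x ρ) (λ x → sum λ v → sum λ w → good-step v w k u x ρ) ⟩
      sum (λ x → joint u x ρ) +ᶠ sum (λ x → sum λ v → sum λ w → good-step v w k u x ρ)
        ≈⟨ +-cong (sym here-cut) reorder ⟩
      sum (λ v → sum λ w → δ v (guarded v w) u ρ) +ᶠ sum (λ v → sum λ w → sum λ x → good-step v w k u x ρ)
        ≈⟨ ∑-distrib-+ (λ v → sum λ w → δ v (guarded v w) u ρ)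
                       (λ v → sum λ w → sum λ x → good-step v w k u x ρ) ⟨
      sum (λ v → (sum λ w → δ v (guarded v w) u ρ) +ᶠ sum λ w → sum λ x → good-step v w k u x ρ)
        ≈⟨ sum-cong-≋ (λ v → ∑-distrib-+ (λ w → δ v (guarded v w) u ρ)
                                         (λ w → sum λ x → good-step v w k u x ρ)) ⟨
      sum (λ v → sum λ w → cut v w (suc k) u ρ) ∎
      where
      next-layer : ∀ {x a} → edge u x ≡ just a → k + layer x ≡ depth
      next-layer {x} e = ≡.trans (≡.cong (k +_) (edge-layer (_ , e))) (≡.trans (ℕ.+-suc k _) eq)

      by-step : ∀ x → act (edge u x) (total k x) ρ
                    ≈ joint u x ρ +ᶠ sum λ v → sum λ w → good-step v w k u x ρ
      by-step x with bad x in bad-x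
      ... | true = begin
        act (edge u x) (total k x) ρ
          ≈⟨ act-cong (edge u x) (λ a e ρ → reflexive (≡.cong (λ k → total k x ρ)
               (≡.sym (≡.trans (≡.cong (_∸ layer x) (≡.sym (next-layer e))) (ℕ.m+n∸n≡m k (layer x)))))) ρ ⟩
        act (edge u x) (total (depth ∸ layer x) x) ρ        ≈⟨ +-identityʳ _ ⟨
        act (edge u x) (total (depth ∸ layer x) x) ρ +ᶠ 0#
          ≈⟨ +-congˡ (sym (sum-zero {S} λ v → sum-zero {S} {λ _ → 0#} λ w → refl)) ⟩
        _ ∎
      ... | false = begin
        act (edge u x) (total k x) ρ
          ≈⟨ act-cong (edge u x) (λ a e → total-cut k x (next-layer e) bad-x) ρ ⟩
        act (edge u x) (λ ρ → sum λ v → sum λ w → cut v w k x ρ) ρ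
          ≈⟨ act-sum (edge u x) (λ v ρ → sum λ w → cut v w k x ρ) ρ ⟩
        sum (λ v → act (edge u x) (λ ρ → sum λ w → cut v w k x ρ) ρ)
          ≈⟨ sum-cong-≋ (λ v → act-sum (edge u x) (λ w → cut v w k x) ρ) ⟩
        sum (λ v → sum λ w → act (edge u x) (cut v w k x) ρ)  ≈⟨ +-identityˡ _ ⟨
        0# +ᶠ sum (λ v → sum λ w → act (edge u x) (cut v w k x) ρ) ∎

      here-cut : sum (λ v → sum λ w → δ v (guarded v w) u ρ) ≈ sum (λ x → joint u x ρ)
      here-cut = begin
        sum (λ v → sum λ w → δ v (guarded v w) u ρ)
          ≈⟨ sum-only u (λ v v≢u → sum-zero λ w → reflexive (δ-off (v≢u ∘ ≡.sym) (guarded v w) ρ)) ⟩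
        sum (λ w → δ u (guarded u w) u ρ)
          ≈⟨ sum-cong-≋ {S} (λ w → reflexive (≡.trans (δ-on u (guarded u w) ρ)
               (≡.cong (λ z → if z then 0# else joint u w ρ) good))) ⟩
        sum (λ w → joint u w ρ) ∎

      reorder : sum (λ x → sum λ v → sum λ w → good-step v w k u x ρ)
              ≈ sum (λ v → sum λ w → sum λ x → good-step v w k u x ρ)
      reorder = trans (∑-comm (λ x v → sum λ w → good-step v w k u x ρ))
                      (sum-cong-≋ λ v → ∑-comm (λ x w → good-step v w k u x ρ))

  -- Separability from short chains of bad pairs.

  Occurs : Bool → Fin S → Fin S → Set c
  Occurs d u v = ∃[ x ] color x ≡ d × _∈X⟨_,_⟩ P x u v

  Bad : Fin S → Fin S → Set c
  Bad u v = Occurs true u v × Occurs false u v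

  ¬Bad-loop : ∀ {u} → ¬ Bad u u
  ¬Bad-loop ((x , _ , p , x∈) , _) with variables P p | loop-free p
  ¬Bad-loop ((x , _ , p , ()) , _) | _ | ≡.refl

  -- Chains of consecutive bad pairs starting at `u` have at most the given number of links.
  ShortChains : ℕ → Fin S → Set c
  ShortChains zero    u = ∀ v → ¬ Bad u v
  ShortChains (suc j) u = ∀ v → Bad u v → ShortChains j v

  -- Occurrence is taken as decidable here; the final use supplies this under a double negation.
  module _ (occurs? : ∀ d u v → Dec (Occurs d u v)) where

    bad? : ∀ u v → Dec (Bad u v)
    bad? u v = occurs? true u v ×-dec occurs? false u v

    monochromatic : ∀ {u v} → ¬ Bad u v → ∃[ d ] ∀ x → _∈X⟨_,_⟩ P x u v → color x ≡ d
    monochromatic {u} {v} good with occurs? true u v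
    ... | no none = false , λ x x∈ → not-true λ eq → none (x , eq , x∈)
      where
      not-true : ∀ {d} → d ≢ true → d ≡ false
      not-true {true}  h = contradiction ≡.refl h
      not-true {false} h = ≡.refl
    ... | yes some = true , λ x x∈ → not-false λ eq → good (some , x , eq , x∈)
      where
      not-false : ∀ {d} → d ≢ false → d ≡ true
      not-false {true}  h = ≡.refl
      not-false {false} h = contradiction ≡.refl h

    good-total-separable : ∀ {u} → ¬ Bad u sink → ∀ j k → Separable true ((S * S) ^ j) (total k u)
    -- The single term is padded to the uniform bound, which is positive because the node `u` forces
    -- `S` to be nonzero.
    good-total-separable {u} good j k = separable-mono (1≤ u)
      (separable-swap true (total-separable (proj₂ (monochromatic good)) k))
      where
      1≤ : ∀ {S} → Fin S → 1 ≤ (S * S) ^ j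
      1≤ {suc S} _ = ℕ.m^n>0 (suc S * suc S) j

    short-separable : ∀ j {u} → ShortChains j u → ∀ k → k + layer u ≡ depth →
                      Separable true ((S * S) ^ j) (total k u)
    short-separable zero    {u} short k eq = good-total-separable (short sink) 0 k
    short-separable (suc j) {u} short k eq with bad? u sink
    ... | no good = good-total-separable good (suc j) k
    ... | yes bad-sink =
      ≡.subst (λ N → Separable true N (total k u)) (≡.sym (ℕ.*-assoc S S _))
        -- The start `u` is good relative to itself, as a path from `u` to `u` carries no variables.
        (separable-cong (total-cut k u eq (dec-false (bad? u u) ¬Bad-loop))
          (separable-sum λ v → separable-sum λ w → cut-separable v w))
      where
      open Cut (λ v → does (bad? u v)) (dec-true (bad? u sink) bad-sink)
      N = (S * S) ^ j

      unguarded : ∀ {v} → ¬ Bad u v → ∀ w ρ → guarded v w ρ ≡ joint v w ρ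
      unguarded {v} good w ρ rewrite dec-false (bad? u v) good = ≡.refl

      guarded-vanish : ∀ {v} → Bad u v → ∀ w ρ → guarded v w ρ ≡ 0#
      guarded-vanish {v} bad w ρ rewrite dec-true (bad? u v) bad = ≡.refl

      joint-separable : ∀ v w → Separable true N (joint v w)
      joint-separable v w = separable-if (bad? u w) λ bad →
        separable-act (edge v w) (short-separable j (short w bad) _ (ℕ.m∸n+n≡m (layer≤depth w)))

      cut-separable : ∀ v w → Separable true N (cut v w k u)
      cut-separable v w with bad? u v
      ... | yes bad = separable-zero (walk-vanish _ _ _ k u λ v′ _ → (λ _ → refl) , at v′)
        where
        at : ∀ v′ ρ → δ v (guarded v w) v′ ρ ≈ 0#
        at v′ ρ with v′ Fin.≟ v
        ... | yes _ = reflexive (guarded-vanish bad w ρ)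
        ... | no _  = refl
      -- Before `v` only the colour `d` occurs. Swapping the decomposition of the rest to `d` holds
      -- the factors of the other colour fixed, so prepending the prefixes keeps the number of terms
      -- at `N`.
      ... | no good =
        let d , mono = monochromatic good
            _ , f = separable-cong (λ ρ → reflexive (unguarded good w ρ))
                      (separable-swap d (joint-separable v w))
        in separable-swap true (_ , walk-factored _ _ _ v
             (λ v′ v′≢v → (λ _ → refl) , λ ρ → reflexive (δ-off v′≢v (guarded v w) ρ))
             (factored-zero (λ _ → refl) , factored-cong (λ ρ → reflexive (δ-on v (guarded v w) ρ)) f)
             k u mono)

  -- Evaluation of the computed polynomial on states.

  ⟦_⟧ : List (Fin n) → Functional
  ⟦ [] ⟧    ρ = empty ρ
  ⟦ x ∷ w ⟧ ρ = ⟦ w ⟧ (extend x ρ)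

  listSum : ∀ {a} {A : Set a} → (A → Carrier) → List A → Carrier
  listSum f = List.foldr (λ x s → f x +ᶠ s) 0#

  listSum-++ : ∀ {a} {A : Set a} (f : A → Carrier) xs ys →
               listSum f (xs ++ ys) ≈ listSum f xs +ᶠ listSum f ys
  listSum-++ f []       ys = sym (+-identityˡ _)
  listSum-++ f (x ∷ xs) ys = trans (+-congˡ (listSum-++ f xs ys)) (sym (+-assoc _ _ _))

  listSum-concatMap : ∀ {a b} {A : Set a} {B : Set b} (f : B → Carrier) (g : A → List B) xs →
                      listSum f (concatMap g xs) ≈ listSum (listSum f ∘ g) xs
  listSum-concatMap f g []       = refl
  listSum-concatMap f g (x ∷ xs) =
    trans (listSum-++ f (g x) (concatMap g xs)) (+-congˡ (listSum-concatMap f g xs))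

  listSum-map : ∀ {a b} {A : Set a} {B : Set b} (f : B → Carrier) (g : A → B) xs →
                listSum f (List.map g xs) ≡ listSum (f ∘ g) xs
  listSum-map f g []       = ≡.refl
  listSum-map f g (x ∷ xs) = ≡.cong (f (g x) +ᶠ_) (listSum-map f g xs)

  listSum-tabulate : ∀ {a} {A : Set a} {k} (f : A → Carrier) (g : Fin k → A) →
                     listSum f (tabulate g) ≡ sum (f ∘ g)
  listSum-tabulate {k = zero}  f g = ≡.refl
  listSum-tabulate {k = suc k} f g = ≡.cong (f (g zero) +ᶠ_) (listSum-tabulate f (g ∘ suc))

  listSum-scale : ∀ {a} {A : Set a} s (f g : A → Carrier) xs → (∀ x → f x ≈ s *ᶠ g x) →
                  listSum f xs ≈ s *ᶠ listSum g xs
  listSum-scale s f g []       h = sym (zeroʳ s)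
  listSum-scale s f g (x ∷ xs) h =
    trans (+-cong (h x) (listSum-scale s f g xs h)) (sym (distribˡ s _ _))

  value : State → Term F (Fin n) → Carrier
  value ρ (b , w) = b *ᶠ ⟦ w ⟧ ρ

  edges-nothing : ∀ u v → edge u v ≡ nothing → edges P u v ≡ []
  edges-nothing u v with edge u v
  ... | nothing = λ _ → ≡.refl

  edges-just : ∀ u v {a} (eq : edge u v ≡ just a) → edges P u v ≡ [ a , eq ]
  edges-just u v with edge u v
  ... | just a = λ { ≡.refl → ≡.refl }

  -- The recursion of `pathsOfLength` is that of `total`: a variable label shifts the state and a
  -- constant label scales.
  paths-value : ∀ k u ρ → listSum (value ρ ∘ weight P) (pathsOfLength P k u sink) ≈ total k u ρ
  paths-value zero u ρ with u Fin.≟ sink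
  ... | yes ≡.refl = trans (+-identityʳ _) (*-identityˡ _)
  ... | no _       = refl
  paths-value (suc k) u ρ = begin
    listSum f (concatMap through (allFin S))     ≈⟨ listSum-concatMap f through (allFin S) ⟩
    listSum (listSum f ∘ through) (allFin S)     ≡⟨ listSum-tabulate (listSum f ∘ through) id ⟩
    sum (λ w → listSum f (through w))            ≈⟨ sum-cong-≋ (λ w → step w (edge u w) ≡.refl) ⟩
    sum (λ w → act (edge u w) (total k w) ρ)     ≈⟨ +-identityˡ _ ⟨
    total (suc k) u ρ                            ∎
    where
    f : ∀ {u} → Path P u sink → Carrier
    f = value ρ ∘ weight P
    through : Fin S → List (Path P u sink)
    through w = concatMap (λ e → List.map (e ∷_) (pathsOfLength P k w sink)) (edges P u w)
    single : ∀ w {a} (eq : edge u w ≡ just a) → listSum f (through w)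
           ≈ listSum (λ p → value ρ (_·_ P a (weight P p))) (pathsOfLength P k w sink)
    single w {a} eq rewrite edges-just u w eq =
      trans (listSum-++ f (List.map ((_ , eq) ∷_) (pathsOfLength P k w sink)) []) (trans (+-identityʳ _)
        (reflexive (listSum-map f ((_ , eq) ∷_) (pathsOfLength P k w sink))))
    step : ∀ w m → edge u w ≡ m → listSum f (through w) ≈ act m (total k w) ρ
    step w nothing          eq rewrite edges-nothing u w eq = refl
    step w (just (var x))   eq = trans (single w eq) (paths-value k w (extend x ρ))
    step w (just (const a)) eq = trans (single w eq) (trans
      (listSum-scale a (λ p → value ρ (_·_ P (const a) (weight P p))) f (pathsOfLength P k w sink)
        (λ p → *-assoc _ _ _)) (*-congˡ (paths-value k w ρ)))

  computed-value : ∀ ρ → listSum (value ρ) (computed P) ≈ total depth source ρ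
  computed-value ρ = trans (reflexive (listSum-map (value ρ) (weight P) (pathsOfLength P depth source sink)))
                           (paths-value depth source ρ)

  computed-separable : (∀ d u v → Dec (Occurs d u v)) → ∀ j → ShortChains j source →
                       Separable true ((S * S) ^ j) λ ρ → listSum (value ρ) (computed P)
  computed-separable occurs? j short = separable-cong computed-value
    (short-separable occurs? j short depth
      (≡.trans (≡.cong (depth +_) (Equivalence.from (layer-source source) ≡.refl)) (ℕ.+-identityʳ depth)))

-- Reading matrix entries off a functional.

isY : ∀ {h} → Y∪Z h → Bool
isY (inj₁ _) = true
isY (inj₂ _) = false

module Monomials {c ℓ} (F : Field c ℓ) {n h : ℕ} (φ : Fin n → Y∪Z h) where
  open Field F hiding (zero)

  color : Fin n → Bool
  color = isY ∘ φ

  open Separability F color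

  part : Bool → List (Fin n) → List (Fin n)
  part d = filter (λ x → color x Bool.≟ d)

  extend-part : ∀ x ρ d w → extend x ρ d (part d w) ≡ ρ d (part d (x ∷ w))
  extend-part x ρ d w with does (color x Bool.≟ d)
  ... | true  = ≡.refl
  ... | false = ≡.refl

  -- Deleting the letters of the other colour leaves the occurrences of `v` alone, since `φ` sends
  -- only letters of colour `isY v` to `v`.
  exponent-part : ∀ v w → exponent v (List.map φ (part (isY v) w)) ≡ exponent v (List.map φ w)
  exponent-part v [] = ≡.refl
  exponent-part v (x ∷ w) with color x Bool.≟ isY v
  ... | no differ = ≡.trans (exponent-part v w) (≡.cong List.length (≡.sym
          (filter-reject (v ≟ᵛ_) {φ x} {List.map φ w} λ v≡φx → differ (≡.cong isY (≡.sym v≡φx)))))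
  ... | yes _ with does (v ≟ᵛ φ x)
  ...   | true  = ≡.cong suc (exponent-part v w)
  ...   | false = exponent-part v w

  matches? : (side : Fin h → Y∪Z h) (p : Subset h) (w : List (Fin n)) →
             Dec (∀ y → exponent (side y) (List.map φ w) ≡ indicator (Vec.lookup p y))
  matches? side p w = Fin.all? λ y → _ ℕ.≟ _

  matches-part : ∀ side d → (∀ y → isY (side y) ≡ d) → ∀ p w →
                 does (matches? side p (part d w)) ≡ does (matches? side p w)
  matches-part side d same p w = does-⇔
    (mk⇔ (λ f y → ≡.trans (≡.sym (eq y)) (f y)) (λ f y → ≡.trans (eq y) (f y)))
    (matches? side p (part d w)) (matches? side p w)
    where
    eq : ∀ y → exponent (side y) (List.map φ (part d w)) ≡ exponent (side y) (List.map φ w)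
    eq y = ≡.subst (λ d → exponent (side y) (List.map φ (part d w)) ≡ exponent (side y) (List.map φ w))
             (same y) (exponent-part (side y) w)

  bit : Bool → Carrier
  bit b = if b then 1# else 0#

  bit-∧ : ∀ b b′ → bit b *ᶠ bit b′ ≈ bit (b ∧ b′)
  bit-∧ true  b′ = *-identityˡ _
  bit-∧ false b′ = zeroˡ _

  -- Evaluation at this state extracts the coefficient at `p` and `q`. Its `true` component depends
  -- on `p` alone and its `false` component on `q` alone, which turns a separable functional into a
  -- matrix factorization.
  detector : Subset h → Subset h → State
  detector p q true  w = bit (does (matches? inj₁ p w))
  detector p q false w = bit (does (matches? inj₂ q w))

  module _ {S} (P : ABP F n S) where
    open Program P color

    word-value : ∀ w ρ → ⟦ w ⟧ ρ ≡ ρ true (part true w) *ᶠ ρ false (part false w)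
    word-value []      ρ = ≡.refl
    word-value (x ∷ w) ρ = ≡.trans (word-value w (extend x ρ))
      (≡.cong₂ _*ᶠ_ (extend-part x ρ true w) (extend-part x ρ false w))

    detect : ∀ p q w → ⟦ w ⟧ (detector p q) ≈ bit (does (isMonomial? p q (List.map φ w)))
    detect p q w = trans
      (reflexive (≡.trans (word-value w (detector p q)) (≡.cong₂ (λ b b′ → bit b *ᶠ bit b′)
        (matches-part inj₁ true (λ _ → ≡.refl) p w) (matches-part inj₂ false (λ _ → ≡.refl) q w))))
      -- `isMonomial?` is a product of two decisions, so its Boolean is by definition the
      -- conjunction of theirs.
      (bit-∧ (does (matches? inj₁ p w)) (does (matches? inj₂ q w)))

    coefficient-value : ∀ f p q →
      coefficient F (rename F φ f) p q ≈ listSum (value (detector p q)) f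
    coefficient-value []            p q = refl
    coefficient-value ((b , w) ∷ f) p q
      with does (isMonomial? p q (List.map φ w)) | detect p q w
    ... | true  | w≈ = +-cong (sym (trans (*-congˡ w≈) (*-identityʳ b))) (coefficient-value f p q)
    ... | false | w≈ = trans (coefficient-value f p q)
                         (sym (trans (+-congʳ (trans (*-congˡ w≈) (zeroʳ b))) (+-identityˡ _)))

-- The partition given by the two halves of the circle.

module HalfCircle (n : ℕ) (2∣n : 2 ∣ n) (π : Permutation′ n) where

  h : ℕ
  h = n / 2

  h+h≡n : h + h ≡ n
  h+h≡n = ≡.trans (≡.sym (≡.trans (ℕ.*-comm h 2) (≡.cong (h +_) (ℕ.+-identityʳ h)))) (m/n*n≡m 2∣n)

  place : Fin n → Y∪Z h
  place k = splitAt h (Fin.cast (≡.sym h+h≡n) k)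

  position : Y∪Z h → Fin n
  position v = Fin.cast h+h≡n (Fin.join h h v)

  place-position : ∀ v → place (position v) ≡ v
  place-position v = ≡.trans
    (≡.cong (splitAt h) (Fin.cast-involutive (≡.sym h+h≡n) h+h≡n (Fin.join h h v)))
    (Fin.splitAt-join h h v)

  position-place : ∀ k → position (place k) ≡ k
  position-place k = ≡.trans (≡.cong (Fin.cast h+h≡n) (Fin.join-splitAt h h _))
    (Fin.cast-involutive h+h≡n (≡.sym h+h≡n) k)

  -- The position of `x` on the circle is `π ⟨$⟩ˡ x`, so the first half of the circle goes to Y and
  -- the second to Z.
  φ : Fin n → Y∪Z h
  φ x = place (π ⟨$⟩ˡ x)

  φ-injective : Injective _≡_ _≡_ φ
  φ-injective {x} {y} eq = ≡.trans (≡.sym (undo x)) (≡.trans (≡.cong (λ v → π ⟨$⟩ʳ position v) eq) (undo y))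
    where
    undo : ∀ x → π ⟨$⟩ʳ position (φ x) ≡ x
    undo x = ≡.trans (≡.cong (π ⟨$⟩ʳ_) (position-place (π ⟨$⟩ˡ x))) (inverseʳ π)

  φ-surjective : ∀ v → ∃[ x ] φ x ≡ v
  φ-surjective v = π ⟨$⟩ʳ position v , ≡.trans (≡.cong place (inverseˡ π)) (place-position v)

  full-size : ∀ {k} (f : Fin k → Bool) → (∀ i → f i ≡ true) → ∣ Vec.tabulate f ∣ ≡ k
  full-size {zero}  f h = ≡.refl
  full-size {suc k} f h rewrite h zero = ≡.cong suc (full-size (f ∘ suc) (h ∘ suc))

  balanced : Balanced (φ , φ-injective)
  balanced = full-size _ (λ y → dec-true (Fin.any? λ x → φ x ≟ᵛ inj₁ y) (φ-surjective (inj₁ y)))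
           , full-size _ (λ z → dec-true (Fin.any? λ x → φ x ≟ᵛ inj₂ z) (φ-surjective (inj₂ z)))

  isY-first : ∀ k → isY (place k) ≡ true → toℕ k < h
  isY-first k eq with place k in e
  ... | inj₁ y = ≡.subst (_< h)
    (≡.trans (≡.sym (Fin.toℕ-↑ˡ y h)) (≡.trans (≡.cong toℕ (Fin.splitAt⁻¹-↑ˡ e)) (Fin.toℕ-cast _ k)))
    (Fin.toℕ<n y)

  isZ-second : ∀ k → isY (place k) ≡ false → h ≤ toℕ k
  isZ-second k eq with place k in e
  ... | inj₂ z = ≡.subst (h ≤_)
    (≡.trans (≡.sym (Fin.toℕ-↑ʳ h z)) (≡.trans (≡.cong toℕ (Fin.splitAt⁻¹-↑ʳ e)) (Fin.toℕ-cast _ k)))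
    (ℕ.m≤m+n h _)

  -- The segments joining the two halves of the circle.
  IsBoundary : Bool → Fin n → Set
  IsBoundary true  k = suc (toℕ k) ≡ h
  IsBoundary false k = ∀ (j : Fin n) → toℕ j ≤ toℕ k

  -- The given position rules out the empty circle, which has no segments.
  boundary : Fin n → ∀ e → ∃ (IsBoundary e)
  boundary k true with h | h+h≡n
  ... | zero  | ≡.refl = contradiction k λ ()
  ... | suc m | ≡.refl = fromℕ< m<n , ≡.cong suc (Fin.toℕ-fromℕ< m<n)
    where m<n = s≤s (ℕ.m≤m+n m (suc m))
  boundary k false = last k
    where
    last : ∀ {n} → Fin n → Σ[ k ∈ Fin n ] ∀ (j : Fin n) → toℕ j ≤ toℕ k
    last {suc n} _ = Fin.fromℕ n , Fin.≤fromℕ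

  module _ (seg : Bool → Fin n) (is-boundary : ∀ e → IsBoundary e (seg e)) where

    -- An arc without wraparound starts in the first half and ends in the second, so it crosses the
    -- middle; a wrapping arc contains the segment from the last position to the first.
    two-sided : ∀ I {k l} → k ∈ᵃ I → l ∈ᵃ I → isY (place k) ≡ true → isY (place l) ≡ false →
                ∃[ e ] ContainsSegment I (seg e)
    two-sided I {k} {l} (inj₁ (f<l , f≤k , _)) (inj₁ (_ , _ , l≤l)) kY lZ = true , inj₁ (f<l
      , ℕ.s≤s⁻¹ (≡.subst (suc (toℕ (Arc.first I)) ≤_) (≡.sym (is-boundary true)) (ℕ.≤-<-trans f≤k (isY-first k kY)))
      , ≡.subst (_≤ toℕ (Arc.last I)) (≡.sym (is-boundary true)) (ℕ.≤-trans (isZ-second l lZ) l≤l))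
    two-sided I (inj₂ (l<f , _)) _ kY lZ = false , inj₂ (l<f , inj₁ (is-boundary false _))
    two-sided I _ (inj₂ (l<f , _)) kY lZ = false , inj₂ (l<f , inj₁ (is-boundary false _))

-- The bound on the length of chains of bad pairs.

module Chains {c ℓ} {F : Field c ℓ} {n S} (2∣n : 2 ∣ n) (P : ABP F n S) (π : Permutation′ n)
              (strict : StrictFor P π) where
  open HalfCircle n 2∣n π
  open Program P (isY ∘ φ)
  open ABP P using (source)

  I = proj₁ strict

  -- Any arc provides the position that `boundary` asks for, and one is at hand because the program
  -- has a source.
  seg : Bool → Fin n
  seg e = proj₁ (boundary (Arc.first (I source source)) e)

  _++ᵖ_ : ∀ {u v w} → Path P u v → Path P v w → Path P u w
  []      ++ᵖ q = q
  (e ∷ p) ++ᵖ q = e ∷ (p ++ᵖ q)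

  variables-++ : ∀ {u v w} (p : Path P u v) (q : Path P v w) {x} →
                 x ∈ variables P p → x ∈ variables P (p ++ᵖ q)
  variables-++ ((var y , _) ∷ p)   q (here eq)  = here eq
  variables-++ ((var y , _) ∷ p)   q (there x∈) = there (variables-++ p q x∈)
  variables-++ ((const _ , _) ∷ p) q x∈         = variables-++ p q x∈

  Occurs-++ : ∀ {d u v w} → Path P v w → Occurs d u v → Occurs d u w
  Occurs-++ q (x , eq , p , x∈) = x , eq , p ++ᵖ q , variables-++ p q x∈

  path : ∀ {u v} → Bad u v → Path P u v
  path ((_ , _ , p , _) , _) = p

  ≢-nodes : ∀ {u v} → Bad u v → u ≢ v
  ≢-nodes bad ≡.refl = ¬Bad-loop bad

  crossing : ∀ {u v} → Bad u v → ∃[ e ] ContainsSegment (I u v) (seg e)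
  crossing {u} {v} ((x , xY , x∈) , (z , zZ , z∈))
    with proj₁ (proj₂ strict) u v x x∈ | proj₁ (proj₂ strict) u v z z∈
  ... | k , k∈ , ≡.refl | l , l∈ , ≡.refl =
    two-sided seg (λ e → proj₂ (boundary _ e)) (I u v) k∈ l∈
      (≡.trans (≡.cong (isY ∘ place) (≡.sym (inverseˡ π))) xY)
      (≡.trans (≡.cong (isY ∘ place) (≡.sym (inverseˡ π))) zZ)

  side : ∀ {u v} → Bad u v → Bool
  side = proj₁ ∘ crossing

  -- A boundary segment common to the arcs of two consecutive pairs would make them overlap.
  side-≢ : ∀ {u a v} (b : Bad u a) (b′ : Bad a v) → side b ≢ side b′
  side-≢ {u} {a} {v} b b′ eq = proj₂ (proj₂ strict) u a v (≢-nodes b) (≢-nodes b′) (path b) (path b′)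
    (inj₂ (seg (side b) , proj₂ (crossing b)
          , ≡.subst (ContainsSegment (I a v) ∘ seg) (≡.sym eq) (proj₂ (crossing b′))))

  pigeonhole : ∀ {a b c : Bool} → a ≢ b → a ≢ c → b ≡ c
  pigeonhole {b = false} {false} _ _ = ≡.refl
  pigeonhole {b = true}  {true}  _ _ = ≡.refl
  pigeonhole {false} {false} {true}  a≢b _ = contradiction ≡.refl a≢b
  pigeonhole {true}  {false} {true}  _ a≢c = contradiction ≡.refl a≢c
  pigeonhole {false} {true}  {false} _ a≢c = contradiction ≡.refl a≢c
  pigeonhole {true}  {true}  {false} a≢b _ = contradiction ≡.refl a≢b

  short-chains : ShortChains 3 source
  short-chains w₁ b₀₁ w₂ b₁₂ w₃ b₂₃ w₄ b₃₄ = side-≢ b₁₂ b₂₃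
    (≡.trans (pigeonhole (side-≢ b₀₁ b₁₂) (side-≢ b₀₁ b₁₃))
             (pigeonhole (side-≢ b₁₃ b₃₄ ∘ ≡.sym) (side-≢ b₂₃ b₃₄ ∘ ≡.sym)))
    where
    -- Paths from `w₁` to `w₂` extend to `w₃`, so both colours persist.
    b₁₃ : Bad w₁ w₃
    b₁₃ = Occurs-++ (path b₂₃) (proj₁ b₁₂) , Occurs-++ (path b₂₃) (proj₂ b₁₂)

-- Enumeration of subsets, double negation and the numerical estimate.

subset : ∀ {h} → Fin (2 ^ h) → Subset h
subset {h} i = Vec.tabulate λ j → Inverse.to Fin.2↔Bool (Fin.finToFun {2} {h} i j)

subset-surjective : ∀ {h} (p : Subset h) → ∃[ i ] subset i ≡ p
subset-surjective p = Fin.funToFin (Inverse.from Fin.2↔Bool ∘ Vec.lookup p) ,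
  ≡.trans (Vec.tabulate-cong λ j → ≡.trans
      (≡.cong (Inverse.to Fin.2↔Bool) (Fin.finToFun-funToFin (Inverse.from Fin.2↔Bool ∘ Vec.lookup p) j))
      (Inverse.strictlyInverseˡ Fin.2↔Bool (Vec.lookup p j)))
    (Vec.tabulate∘lookup p)

-- Double-negation shift, valid over a finite index set by sequencing in the double negation monad.
¬¬-finite : ∀ {p k} {A : Fin k → Set p} → (∀ i → ¬ ¬ A i) → ¬ ¬ (∀ i → A i)
¬¬-finite = Fin.sequence (RawMonad.rawApplicative ¬¬-Monad)

¬¬-Bool : ∀ {p} {A : Bool → Set p} → (∀ b → ¬ ¬ A b) → ¬ ¬ (∀ b → A b)
¬¬-Bool f k = f true λ t → f false λ s → k λ { true → t ; false → s }

square-cancel-≤ : ∀ {x y} → x * x ≤ y * y → x ≤ y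
square-cancel-≤ xx≤yy = ℕ.≮⇒≥ λ y<x → ℕ.<⇒≱ (ℕ.*-mono-< y<x y<x) xx≤yy

^-cancelʳ-≤ : ∀ {x y} → 2 ^ x ≤ 2 ^ y → x ≤ y
^-cancelʳ-≤ le = ℕ.≮⇒≥ λ y<x → ℕ.<⇒≱ (ℕ.^-monoʳ-< 2 (s≤s (s≤s z≤n)) y<x) le

rank-bound : ∀ {h S r} → 0 < h → r ≤ 2 ^ h → r ≤ (S * S) ^ 3 → RankBound (h + h) S r
rank-bound {h} {S} {r} 0<h r≤2^h r≤S^6 a b g d √n≤ log-n≤ log-S≤ with h ℕ.≤? 2
... | yes h≤2 = begin
  r ^ (d * d * d)                  ≤⟨ ℕ.^-monoˡ-≤ (d * d * d) r≤2^h ⟩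
  (2 ^ h) ^ (d * d * d)          ≡⟨ ℕ.^-*-assoc 2 h (d * d * d) ⟩
  2 ^ (h * (d * d * d))          ≤⟨ ℕ.^-monoʳ-≤ 2 exponents ⟩
  2 ^ (a * b * g + a * (d * d)) ∎
  where
  open ℕ.≤-Reasoning
  -- Squared, `h ≤ √ (h + h)` is `h * h ≤ h * 2`, which holds as `h ≤ 2`.
  hd≤a : h * d ≤ a
  hd≤a = square-cancel-≤ (begin
    h * d * (h * d)      ≡⟨ arrange h d ⟩
    h * h * (d * d)      ≤⟨ ℕ.*-monoˡ-≤ (d * d) (ℕ.*-monoʳ-≤ h h≤2) ⟩
    h * 2 * (d * d)      ≡⟨ arrange′ h d ⟩
    (h + h) * (d * d)    ≤⟨ √n≤ ⟩
    a * a ∎)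
    where
    arrange : ∀ h d → h * d * (h * d) ≡ h * h * (d * d)
    arrange = solve-∀
    arrange′ : ∀ h d → h * 2 * (d * d) ≡ (h + h) * (d * d)
    arrange′ = solve-∀
  exponents : h * (d * d * d) ≤ a * b * g + a * (d * d)
  exponents = begin
    h * (d * d * d)   ≡⟨ arrange h d ⟩
    h * d * (d * d)   ≤⟨ ℕ.*-monoˡ-≤ (d * d) hd≤a ⟩
    a * (d * d)         ≤⟨ ℕ.m≤n+m _ _ ⟩
    a * b * g + a * (d * d) ∎
    where
    arrange : ∀ h d → h * (d * d * d) ≡ h * d * (d * d)
    arrange = solve-∀
... | no h≰2 = begin
  r ^ (d * d * d)                        ≤⟨ ℕ.^-monoˡ-≤ (d * d * d) r≤S^6 ⟩
  ((S * S) ^ 3) ^ (d * d * d)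
    ≡⟨ ≡.cong (_^ (d * d * d)) (power S) ⟩
  (S ^ 6) ^ (d * d * d)                ≡⟨ ℕ.^-*-assoc S 6 (d * d * d) ⟩
  S ^ (6 * (d * d * d))                ≡⟨ ≡.cong (S ^_) (arrange d) ⟩
  S ^ (d * (6 * (d * d)))              ≡⟨ ℕ.^-*-assoc S d (6 * (d * d)) ⟨
  (S ^ d) ^ (6 * (d * d))              ≤⟨ ℕ.^-monoˡ-≤ (6 * (d * d)) log-S≤ ⟩
  (2 ^ g) ^ (6 * (d * d))              ≡⟨ ℕ.^-*-assoc 2 g (6 * (d * d)) ⟩
  2 ^ (g * (6 * (d * d)))              ≤⟨ ℕ.^-monoʳ-≤ 2 exponents ⟩
  2 ^ (a * b * g + a * (d * d))    ∎
  where
  open ℕ.≤-Reasoning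
  6≤n : 6 ≤ h + h
  6≤n = ℕ.+-mono-≤ (ℕ.≰⇒> h≰2) (ℕ.≰⇒> h≰2)
  power : ∀ S → (S * S) ^ 3 ≡ S ^ 6
  power S = ≡.trans (≡.cong (λ x → (S * x) ^ 3) (≡.sym (ℕ.*-identityʳ S))) (ℕ.^-*-assoc S 2 3)
  arrange : ∀ d → 6 * (d * d * d) ≡ d * (6 * (d * d))
  arrange = solve-∀
  -- 12/5 ≤ √6 and 5/2 ≤ log₂ 6, whose product is 6.
  12d≤5a : 12 * d ≤ 5 * a
  12d≤5a = square-cancel-≤ (begin
    12 * d * (12 * d)          ≡⟨ squares 12 d ⟩
    144 * (d * d)                ≤⟨ ℕ.*-monoˡ-≤ (d * d) (ℕ.m≤m+n 144 6) ⟩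
    150 * (d * d)                ≡⟨ ℕ.*-assoc 25 6 (d * d) ⟩
    25 * (6 * (d * d))         ≤⟨ ℕ.*-monoʳ-≤ 25 (ℕ.*-monoˡ-≤ (d * d) 6≤n) ⟩
    25 * ((h + h) * (d * d)) ≤⟨ ℕ.*-monoʳ-≤ 25 √n≤ ⟩
    25 * (a * a)                 ≡⟨ squares 5 a ⟨
    5 * a * (5 * a)            ∎)
    where
    squares : ∀ k x → k * x * (k * x) ≡ k * k * (x * x)
    squares = solve-∀
  5d≤2b : 5 * d ≤ 2 * b
  5d≤2b = ^-cancelʳ-≤ (begin
    2 ^ (5 * d)       ≡⟨ ℕ.^-*-assoc 2 5 d ⟨
    32 ^ d              ≤⟨ ℕ.^-monoˡ-≤ d (ℕ.m≤m+n 32 4) ⟩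
    36 ^ d              ≡⟨ ℕ.^-*-assoc 6 2 d ⟩
    6 ^ (2 * d)       ≡⟨ ≡.cong (6 ℕ.^_) (ℕ.*-comm 2 d) ⟩
    6 ^ (d * 2)       ≡⟨ ℕ.^-*-assoc 6 d 2 ⟨
    (6 ^ d) ^ 2       ≤⟨ ℕ.^-monoˡ-≤ 2 (ℕ.≤-trans (ℕ.^-monoˡ-≤ d 6≤n) log-n≤) ⟩
    (2 ^ b) ^ 2       ≡⟨ ℕ.^-*-assoc 2 b 2 ⟩
    2 ^ (b * 2)       ≡⟨ ≡.cong (2 ℕ.^_) (ℕ.*-comm b 2) ⟩
    2 ^ (2 * b)       ∎)
  6dd≤ab : 6 * (d * d) ≤ a * b
  6dd≤ab = ℕ.*-cancelˡ-≤ 10 (begin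
    10 * (6 * (d * d))     ≡⟨ left d ⟩
    12 * d * (5 * d)       ≤⟨ ℕ.*-mono-≤ 12d≤5a 5d≤2b ⟩
    5 * a * (2 * b)        ≡⟨ right a b ⟩
    10 * (a * b)             ∎)
    where
    left : ∀ d → 10 * (6 * (d * d)) ≡ 12 * d * (5 * d)
    left = solve-∀
    right : ∀ a b → 5 * a * (2 * b) ≡ 10 * (a * b)
    right = solve-∀
  exponents : g * (6 * (d * d)) ≤ a * b * g + a * (d * d)
  exponents = begin
    g * (6 * (d * d))   ≤⟨ ℕ.*-monoʳ-≤ g 6dd≤ab ⟩
    g * (a * b)           ≡⟨ ℕ.*-comm g (a * b) ⟩
    a * b * g             ≤⟨ ℕ.m≤m+n _ _ ⟩
    a * b * g + a * (d * d) ∎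

-- The rank bound for the half-circle partition.

theorem4 : ∀ {c ℓ} (F : Field c ℓ) (n S : ℕ) → 2 ∣ n →
    (P : ABP F n S) → StrictCircularInterval P →
    Σ[ φ ∈ Partition n ]
    (Balanced φ ×
    Σ[ r ∈ ℕ ] (IsRank F (partialDerivativeMatrix F φ (computed P)) r × RankBound n S r))
theorem4 F n S 2∣n P (_ , π , strict) =
  (φ , φ-injective) , balanced , r , rank ,
  ≡.subst (λ n → RankBound n S r) h+h≡n
    (rank-bound 0<h (rank≤columns M subset subset-surjective rank) r≤S^6)
  where
  open HalfCircle n 2∣n π
  open Chains 2∣n P π strict using (short-chains; seg; I)
  open LinearAlgebra F
  open Monomials F φ
  open Separability F color
  open Program P color
  open Field F using (trans)
  open ABP P using (source)
  M = partialDerivativeMatrix F (φ , φ-injective) (computed P)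
  existence = rank-exists M subset subset-surjective subset subset-surjective
  r = proj₁ existence
  rank = proj₂ existence
  0<h : 0 < h
  -- The middle segment exists, and the successor of its first endpoint is `h`.
  0<h with boundary (Arc.first (I source source)) true
  ... | k , eq = ≡.subst (0 <_) eq (s≤s z≤n)
  r≤S^6 : r ≤ (S * S) ^ 3
  -- The inequality is decidable and hence stable, so the finitely many occurrence questions may be
  -- decided under a double negation.
  r≤S^6 = decidable-stable (_ ℕ.≤? _) λ r≰ →
    ¬¬-Bool (λ d → ¬¬-finite λ u → ¬¬-finite λ v → ¬¬-excluded-middle {A = Occurs d u v}) λ occurs? →
    let b , factored a f≈ = computed-separable occurs? 3 short-chains in
    -- The second `p` and the first `q` are placeholders: `detector` reads only its first subset at
    -- `true` and only its second at `false`.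
    r≰ (rank≤factorization M (λ i p → a i (detector p p true)) (λ i q → b i (detector q q false))
         (λ p q → trans (coefficient-value P (computed P) p q) (f≈ (detector p q))) rank)
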